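{- There is an absolute constant $C$ such that the following holds. Let $G=(V,E)$ be a finite connected simple graph with $n$ vertices, $m$ edges, minimum degree $\delta$ and maximum degree $\Delta$, and consider any unweighted deterministic walk on $G$ with $\tilde\kappa=1$ (each rotor sequence is a permutation of the neighbours), any initial rotor positions and any start vertex. Then for every $1\le\mathcal N\le n$, the walk has visited at least $\mathcal N$ distinct vertices within $C\min\{\mathcal N\Delta+(\mathcal N\Delta/\delta)^2,\ m+(m/\delta)^2\}$ steps, and for every $1\le\mathcal M\le m$, it has traversed at least $\mathcal M$ distinct edges within $C\,(\mathcal M+(\mathcal M/\delta)^2)$ steps.
   Context: Unweighted deterministic walk: each vertex $u$ has a rotor sequence of length $\tilde d(u)$ of neighbours of $u$, each occurring exactly $\tilde d(u)/\deg(u)$ times, and an initial rotor position; $\tilde\kappa=\max_u\tilde d(u)/\deg(u)$. From the current vertex $\tilde x_t$ the walk moves to $\tilde x_{t+1}$, the vertex the rotor of $\tilde x_t$ points at, after which that rotor advances cyclically to the next entry of its sequence; the edge traversed in step $t+1$ is $\{\tilde x_t,\tilde x_{t+1}\}$. -}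

module Defs where

open import Data.Nat using (ℕ; zero; suc; _+_; _*_; _≤_; _<_; _%_; _<ᵇ_)
open import Data.Bool using (Bool; true; false; _∧_)
open import Data.Bool.Properties using () renaming (_≟_ to _≟B_)
open import Data.Fin using (Fin; toℕ)
open import Data.Fin.Properties using () renaming (_≟_ to _≟F_)
open import Data.List using (List; []; _∷_; length; filter; upTo; allFin; lookup; map)
open import Data.Nat.ListAction using (sum)
open import Data.Bool.ListAction using (any)
open import Data.Nat.DivMod using (m%n<n)
open import Data.Bool using (if_then_else_; _∨_)
open import Data.Fin using (fromℕ<)
open import Data.List.Relation.Unary.Unique.Propositional using (Unique)
open import Data.List.Membership.Propositional using (_∈_)
open import Data.Product using (_×_; _,_; proj₁; proj₂; Σ; ∃)
open import Relation.Binary.PropositionalEquality using (_≡_)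
open import Relation.Nullary.Decidable using (⌊_⌋)
open import Function.Bundles using (_⇔_)

record SimpleGraph (n : ℕ) : Set where
  field
    adj   : Fin n → Fin n → Bool
    sym   : ∀ u v → adj u v ≡ adj v u
    irref : ∀ u → adj u u ≡ false
open SimpleGraph public

countFin : (n : ℕ) → (Fin n → Bool) → ℕ
countFin n p = length (filter (λ i → p i ≟B true) (allFin n))

deg : ∀ {n} → SimpleGraph n → Fin n → ℕ
deg {n} G u = countFin n (adj G u)

edgeCount : ∀ {n} → SimpleGraph n → ℕ
edgeCount {n} G =
  sum (map (λ i → countFin n (λ j → adj G i j ∧ (toℕ i <ᵇ toℕ j))) (allFin n))

data Reach {n : ℕ} (G : SimpleGraph n) : Fin n → Fin n → Set where
  here : ∀ {u} → Reach G u u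
  step : ∀ {u w v} → adj G u w ≡ true → Reach G w v → Reach G u v

Connected : ∀ {n} → SimpleGraph n → Set
Connected G = ∀ u v → Reach G u v

IsMinDegree IsMaxDegree : ∀ {n} → SimpleGraph n → ℕ → Set
IsMinDegree G δ = (∀ u → δ ≤ deg G u) × ∃ (λ u → deg G u ≡ δ)
IsMaxDegree G Δ = (∀ u → deg G u ≤ Δ) × ∃ (λ u → deg G u ≡ Δ)

record RotorSystem {n : ℕ} (G : SimpleGraph n) : Set where
  field
    rot        : Fin n → List (Fin n)
    rotUnique  : ∀ u → Unique (rot u)
    rotNbrs    : ∀ u v → (v ∈ rot u) ⇔ (adj G u v ≡ true)
    initPos    : ∀ u → Fin (length (rot u))
open RotorSystem public

cycAt : ∀ {A : Set} → List A → A → ℕ → A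
cycAt []       d k = d
cycAt (x ∷ xs) d k = lookup (x ∷ xs) (fromℕ< (m%n<n k (suc (length xs))))

-- state: current vertex and, for each vertex, the (unreduced) index its
-- rotor points at in its rotor sequence (reduced mod its length on use)
State : ℕ → Set
State n = Fin n × (Fin n → ℕ)

module _ {n : ℕ} {G : SimpleGraph n} (R : RotorSystem G) where

  stepState : State n → State n
  stepState (x , p) =
    cycAt (rot R x) x (p x) ,
    (λ u → if ⌊ u ≟F x ⌋ then suc (p u) else p u)

  stateAt : Fin n → ℕ → State n
  stateAt x₀ zero    = x₀ , (λ u → toℕ (initPos R u))
  stateAt x₀ (suc t) = stepState (stateAt x₀ t)

  walk : Fin n → ℕ → Fin n
  walk x₀ t = proj₁ (stateAt x₀ t)

  visitedVertices : Fin n → ℕ → ℕ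
  visitedVertices x₀ t =
    countFin n (λ v → any (λ s → ⌊ walk x₀ s ≟F v ⌋) (upTo (suc t)))

  traversedEdges : Fin n → ℕ → ℕ
  traversedEdges x₀ t =
    sum (map (λ i → countFin n (λ j →
           adj G i j ∧ (toℕ i <ᵇ toℕ j) ∧
           any (λ s → (⌊ walk x₀ s ≟F i ⌋ ∧ ⌊ walk x₀ (suc s) ≟F j ⌋)
                    ∨ (⌊ walk x₀ s ≟F j ⌋ ∧ ⌊ walk x₀ (suc s) ≟F i ⌋))
               (upTo t)))
         (allFin n))

{-# OPTIONS --safe #-}
-- Cut the walk into phases, a phase ending when its start vertex x₀ has sent the walk
-- once through each of its arcs.  Within a phase no arc is used twice, so after j
-- completed phases t ≤ (j + 1) · 2E, where E is the number of edges traversed so far.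
-- At the end of a phase every vertex visited before that phase has used each of its arcs
-- once in it: last exits lead to x₀, and if w is saturated then so, by conservation of
-- flow, are all arcs into w, including the last exit of its predecessor.  So phase j + 1
-- exhausts all arcs out of the ball of radius j around x₀.  Unless this ball is the
-- whole graph, it gains δ vertices every three steps and has about jδ/3 vertices of
-- degree at least δ, whence jδ² = O(E) and tδ² = O(Eδ² + E²).
module Submission where

open import Defs
open import Data.Bool using (Bool; true; false; if_then_else_; _∧_; _∨_)
open import Data.Bool.ListAction using (any)
open import Data.Bool.Properties using (∧-assoc; ∧-comm; ∨-zeroʳ; T-≡; ¬-not; not-¬) renaming (_≟_ to _≟B_)
open import Data.Fin using (Fin; zero; suc; toℕ; fromℕ<)
open import Data.Fin.Properties using (toℕ-fromℕ<; toℕ-injective; toℕ<n; any?; suc-injective) renaming (_≟_ to _≟F_)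
open import Data.List using (List; []; _∷_; length; lookup; filter; map; tabulate; allFin; upTo)
open import Data.List.Membership.Propositional using (_∈_; find; lose)
open import Data.List.Membership.Propositional.Properties using (∈-lookup; ∈-upTo⁺; ∈-upTo⁻)
open import Data.List.Properties using (map-tabulate)
open import Data.List.Relation.Unary.All using () renaming (lookup to lookupAll)
open import Data.List.Relation.Unary.AllPairs using (_∷_)
open import Data.List.Relation.Unary.Any using (index)
open import Data.List.Relation.Unary.Any.Properties using (any⁺; any⁻; lookup-index)
open import Data.List.Relation.Unary.Unique.Propositional using (Unique)
open import Data.Nat using (ℕ; zero; suc; _+_; _*_; _^_; _≤_; _<_; _≤?_; _<ᵇ_; z≤n; s≤s; NonZero; >-nonZero; _/_; _%_)
open import Data.Nat.DivMod using (m≡m%n+[m/n]*n; m%n<n; m/n*n≤m; m<n⇒m%n≡m)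
import Data.Nat.ListAction as List
open import Data.Nat.Properties hiding (_≟_; suc-injective)
open import Data.Nat.Tactic.RingSolver using (solve-∀)
open import Data.Product using (_×_; _,_; proj₁; proj₂; Σ; ∃; ∃₂)
open import Data.Sum using (_⊎_; inj₁; inj₂)
open import Function using (_∘_; id; case_of_)
open import Function.Bundles using (Equivalence)
open import Relation.Binary.Definitions using (tri<; tri≈; tri>)
open import Relation.Binary.PropositionalEquality using (_≡_; _≢_; refl; trans; cong; cong₂; subst; subst₂; module ≡-Reasoning) renaming (sym to ≡-sym)
open import Relation.Nullary using (¬_; yes; no; contradiction)
open import Relation.Nullary.Decidable using (⌊_⌋)

open import Algebra.Properties.CommutativeMonoid.Sum +-0-commutativeMonoid
  using (sum; sum-syntax; ∑-distrib-+; ∑-comm; sum-cong-≗)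

variable
  n : ℕ

-- Indicators and finite sums.

⟦_⟧ : Bool → ℕ
⟦ true  ⟧ = 1
⟦ false ⟧ = 0

⟦⟧≤1 : ∀ b → ⟦ b ⟧ ≤ 1
⟦⟧≤1 true  = ≤-refl
⟦⟧≤1 false = z≤n

⟦⟧-mono : ∀ {a b} → (a ≡ true → b ≡ true) → ⟦ a ⟧ ≤ ⟦ b ⟧
⟦⟧-mono {false}     f = z≤n
⟦⟧-mono {true}  {b} f rewrite f refl = ≤-refl

⟦⟧-pos : ∀ {b} → 1 ≤ ⟦ b ⟧ → b ≡ true
⟦⟧-pos {true} _ = refl

≟F-refl : (u : Fin n) → ⌊ u ≟F u ⌋ ≡ true
≟F-refl u with u ≟F u
... | yes _   = refl
... | no  u≢u = contradiction refl u≢u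

≟F-true : (u v : Fin n) → ⌊ u ≟F v ⌋ ≡ true → u ≡ v
≟F-true u v _ with yes u≡v ← u ≟F v = u≡v

δ[_,_] : Fin n → Fin n → ℕ
δ[ u , v ] = ⟦ ⌊ u ≟F v ⌋ ⟧

δ-refl : (u : Fin n) → δ[ u , u ] ≡ 1
δ-refl u = cong ⟦_⟧ (≟F-refl u)

δ-pos : {u v : Fin n} → 1 ≤ δ[ u , v ] → u ≡ v
δ-pos {u = u} {v} p = ≟F-true u v (⟦⟧-pos p)

δ-suc : (u v : Fin n) → δ[ suc u , suc v ] ≡ δ[ u , v ]
δ-suc u v with u ≟F v
... | yes _ = refl
... | no  _ = refl

∑-mono : {f g : Fin n → ℕ} → (∀ i → f i ≤ g i) → sum f ≤ sum g
∑-mono {n = zero}  f≤g = z≤n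
∑-mono {n = suc _} f≤g = +-mono-≤ (f≤g zero) (∑-mono (f≤g ∘ suc))

-- Once the totals meet, no term has slack. Degree counts, saturation of vertices and the traversal
-- of all edges come down to this.
∑-tight : {f g : Fin n → ℕ} → (∀ i → f i ≤ g i) → sum g ≤ sum f → ∀ i → g i ≤ f i
∑-tight {n = suc _} {f} {g} f≤g Σg≤Σf zero =
  +-cancelʳ-≤ (sum (g ∘ suc)) _ _
    (≤-trans Σg≤Σf (+-monoʳ-≤ (f zero) (∑-mono (f≤g ∘ suc))))
∑-tight {n = suc _} {f} {g} f≤g Σg≤Σf (suc i) =
  ∑-tight (f≤g ∘ suc)
    (+-cancelˡ-≤ (g zero) _ _ (≤-trans Σg≤Σf (+-monoˡ-≤ _ (f≤g zero)))) i

term≤∑ : (f : Fin n → ℕ) → ∀ i → f i ≤ sum f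
term≤∑ f zero    = m≤m+n _ _
term≤∑ f (suc i) = ≤-trans (term≤∑ (f ∘ suc) i) (m≤n+m _ _)

∑-zero : {f : Fin n → ℕ} → (∀ i → f i ≡ 0) → sum f ≡ 0
∑-zero {n = zero}  f≡0 = refl
∑-zero {n = suc _} f≡0 = cong₂ _+_ (f≡0 zero) (∑-zero (f≡0 ∘ suc))

∑-const : ∀ n → sum {n} (λ _ → 1) ≡ n
∑-const zero    = refl
∑-const (suc n) = cong suc (∑-const n)

∑-*ʳ : (f : Fin n → ℕ) → ∀ c → sum (λ i → f i * c) ≡ sum f * c
∑-*ʳ {n = zero}  f c = refl
∑-*ʳ {n = suc _} f c = trans (cong (f zero * c +_) (∑-*ʳ (f ∘ suc) c))
                             (≡-sym (*-distribʳ-+ c (f zero) _))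

∑-δ : (u : Fin n) → ∑[ v < n ] δ[ u , v ] ≡ 1
∑-δ {n = suc n} zero    = cong suc (∑-zero {n} (λ _ → refl))
∑-δ {n = suc n} (suc u) = trans (sum-cong-≗ (δ-suc u)) (∑-δ u)

-- One step of the walk alters the exit count of a single vertex; this passes the change on to
-- totals such as elapsed time and inflow.
∑-update : {f g : Fin n → ℕ} (x : Fin n) (d : ℕ) → g x ≡ f x + d →
           (∀ u → u ≢ x → g u ≡ f u) → sum g ≡ sum f + d
∑-update {n = suc n} {f} {g} zero d gx gu =
  trans (cong₂ _+_ gx (sum-cong-≗ (λ i → gu (suc i) λ ())))
        (trans (+-assoc (f zero) d _)
          (trans (cong (f zero +_) (+-comm d _)) (≡-sym (+-assoc (f zero) _ d))))
∑-update {n = suc n} {f} (suc x) d gx gu =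
  trans (cong₂ _+_ (gu zero λ ())
          (∑-update x d gx (λ u u≢x → gu (suc u) (u≢x ∘ suc-injective))))
        (≡-sym (+-assoc (f zero) _ d))

-- Counts over lists as finite sums.

sum-tabulate : (f : Fin n → ℕ) → List.sum (tabulate f) ≡ sum f
sum-tabulate {n = zero}  f = refl
sum-tabulate {n = suc _} f = cong (f zero +_) (sum-tabulate (f ∘ suc))

sum-map-allFin : (f : Fin n → ℕ) → List.sum (map f (allFin n)) ≡ sum f
sum-map-allFin f = trans (cong List.sum (map-tabulate id f)) (sum-tabulate f)

length-filter≡sum : ∀ {A : Set} (p : A → Bool) xs →
  length (filter (λ x → p x ≟B true) xs) ≡ List.sum (map (⟦_⟧ ∘ p) xs)
length-filter≡sum p [] = refl
length-filter≡sum p (x ∷ xs) with p x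
... | true  = cong suc (length-filter≡sum p xs)
... | false = length-filter≡sum p xs

countFin≡∑ : (p : Fin n → Bool) → countFin n p ≡ ∑[ i < n ] ⟦ p i ⟧
countFin≡∑ {n = n} p =
  trans (length-filter≡sum p (allFin n)) (sum-map-allFin (⟦_⟧ ∘ p))

∑-countFin : (p : Fin n → Fin n → Bool) →
  List.sum (map (λ i → countFin n (p i)) (allFin n)) ≡ ∑[ i < n ] ∑[ j < n ] ⟦ p i j ⟧
∑-countFin {n = n} p = trans (sum-map-allFin (λ i → countFin n (p i)))
                             (sum-cong-≗ (λ i → countFin≡∑ (p i)))

-- An unordered pair {i, j} with i ≠ j is counted by exactly one of (i, j) and (j, i).
double-count : (f : Fin n → Fin n → Bool) → (∀ i → f i i ≡ false) →
  (∀ i j → f i j ≡ f j i) →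
  ∑[ i < n ] ∑[ j < n ] ⟦ f i j ⟧ ≡
  2 * List.sum (map (λ i → countFin n (λ j → f i j ∧ (toℕ i <ᵇ toℕ j))) (allFin n))
double-count {n = n} f f-irr f-sym = begin
  ∑[ i < n ] ∑[ j < n ] ⟦ f i j ⟧
    ≡⟨ sum-cong-≗ (λ i → trans (sum-cong-≗ (split i)) (∑-distrib-+ (h i) (λ j → h j i))) ⟩
  ∑[ i < n ] (∑[ j < n ] h i j + ∑[ j < n ] h j i)
    ≡⟨ ∑-distrib-+ (λ i → ∑[ j < n ] h i j) (λ i → ∑[ j < n ] h j i) ⟩
  H + ∑[ i < n ] ∑[ j < n ] h j i
    ≡⟨ cong (H +_) (≡-sym (∑-comm h)) ⟩
  H + H
    ≡⟨ cong (H +_) (≡-sym (+-identityʳ H)) ⟩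
  2 * H
    ≡⟨ cong (2 *_) (≡-sym (∑-countFin (λ i j → f i j ∧ (toℕ i <ᵇ toℕ j)))) ⟩
  2 * List.sum (map (λ i → countFin n (λ j → f i j ∧ (toℕ i <ᵇ toℕ j))) (allFin n)) ∎
  where
  open ≡-Reasoning
  h : Fin n → Fin n → ℕ
  h i j = ⟦ f i j ∧ (toℕ i <ᵇ toℕ j) ⟧
  H = ∑[ i < n ] ∑[ j < n ] h i j
  <ᵇ-true : ∀ {a b} → a < b → (a <ᵇ b) ≡ true
  <ᵇ-true a<b = Equivalence.to T-≡ (<⇒<ᵇ a<b)
  <ᵇ-false : ∀ {a b} → ¬ (a < b) → (a <ᵇ b) ≡ false
  <ᵇ-false {a} {b} a≮b with a <ᵇ b in eq
  ... | false = refl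
  ... | true  = contradiction (<ᵇ⇒< a b (Equivalence.from T-≡ eq)) a≮b
  split : ∀ i j → ⟦ f i j ⟧ ≡ h i j + h j i
  split i j with <-cmp (toℕ i) (toℕ j)
  ... | tri< i<j _ j≮i rewrite <ᵇ-true i<j | <ᵇ-false j≮i | f-sym j i with f i j
  ...   | true  = refl
  ...   | false = refl
  split i j | tri> i≮j _ j<i rewrite <ᵇ-true j<i | <ᵇ-false i≮j | f-sym j i with f i j
  ...   | true  = refl
  ...   | false = refl
  split i j | tri≈ _ i≡j _ with refl ← toℕ-injective i≡j rewrite f-irr i = refl

⟦⟧-disjoint : ∀ {a b c} → (a ≡ true → c ≡ true) → (b ≡ true → c ≡ true) →
              (a ≡ true → b ≢ true) → ⟦ a ⟧ + ⟦ b ⟧ ≤ ⟦ c ⟧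
⟦⟧-disjoint {false}         a⇒c b⇒c ¬ab = ⟦⟧-mono b⇒c
⟦⟧-disjoint {true}  {false} a⇒c b⇒c ¬ab rewrite a⇒c refl = ≤-refl
⟦⟧-disjoint {true}  {true}  a⇒c b⇒c ¬ab = contradiction refl (¬ab refl)

-- Cyclic sequences with distinct entries.

-- Given equal remainders, a smaller quotient of `a` would put `b` at least `n` above `a`, and a
-- larger one would put `b` below `a`.
%-injective-window : ∀ {a b} n .{{_ : NonZero n}} → a ≤ b → b < a + n →
                     a % n ≡ b % n → a ≡ b
%-injective-window {a} {b} n a≤b b<a+n a%n≡b%n = trans a≡ (trans (cong (a % n +_) (cong (_* n) q≡)) (≡-sym b≡))
  where
  a≡ : a ≡ a % n + a / n * n
  a≡ = m≡m%n+[m/n]*n a n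
  b≡ : b ≡ a % n + b / n * n
  b≡ = trans (m≡m%n+[m/n]*n b n) (cong (_+ b / n * n) (≡-sym a%n≡b%n))
  open ≤-Reasoning
  q≡ : a / n ≡ b / n
  q≡ with <-cmp (a / n) (b / n)
  ... | tri≈ _ q≡ _ = q≡
  ... | tri< q< _ _ = contradiction b<a+n (≤⇒≯ (begin
    a + n                       ≡⟨ cong (_+ n) a≡ ⟩
    a % n + a / n * n + n       ≡⟨ +-assoc (a % n) _ n ⟩
    a % n + (a / n * n + n)     ≡⟨ cong (a % n +_) (+-comm _ n) ⟩
    a % n + suc (a / n) * n     ≤⟨ +-monoʳ-≤ (a % n) (*-monoˡ-≤ n q<) ⟩
    a % n + b / n * n           ≡⟨ b≡ ⟨
    b                           ∎))
  ... | tri> _ _ q> = contradiction a≤b (<⇒≱ (begin-strict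
    b                           ≡⟨ b≡ ⟩
    a % n + b / n * n           <⟨ +-monoʳ-< (a % n) (*-monoˡ-< n q>) ⟩
    a % n + a / n * n           ≡⟨ a≡ ⟨
    a                           ∎))

lookup-injective : ∀ {A : Set} {xs : List A} → Unique xs → ∀ i j →
                   lookup xs i ≡ lookup xs j → i ≡ j
lookup-injective (_   ∷ _) zero    zero    _  = refl
lookup-injective (x∉  ∷ _) zero    (suc j) eq = contradiction eq (lookupAll x∉ (∈-lookup j))
lookup-injective (x∉  ∷ _) (suc i) zero    eq = contradiction (≡-sym eq) (lookupAll x∉ (∈-lookup i))
lookup-injective (_   ∷ u) (suc i) (suc j) eq = cong suc (lookup-injective u i j eq)

module _ {A : Set} where

  cycAt-∈ : ∀ (xs : List A) {d} k → 1 ≤ length xs → cycAt xs d k ∈ xs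
  cycAt-∈ (x ∷ xs) k _ = ∈-lookup (fromℕ< (m%n<n k (suc (length xs))))

  ∈⇒cycAt : ∀ {xs : List A} {v} d → v ∈ xs →
            ∃ λ k → k < length xs × cycAt xs d k ≡ v
  ∈⇒cycAt {x ∷ xs} d v∈ = toℕ i , toℕ<n i ,
    trans (cong (lookup (x ∷ xs))
            (toℕ-injective (trans (toℕ-fromℕ< _) (m<n⇒m%n≡m (toℕ<n i)))))
          (≡-sym (lookup-index v∈))
    where i = index v∈

  -- Distinct entries reduce equal values to equal residues. It serves in two ways: within one turn
  -- of a rotor no arc repeats, and a repeated arc certifies a full turn.
  cycAt-injective : ∀ {xs : List A} {d a b} → Unique xs → a ≤ b → b < a + length xs →
                    cycAt xs d a ≡ cycAt xs d b → a ≡ b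
  cycAt-injective {[]} {a = a} uniq a≤b b<a+0 _ =
    contradiction a≤b (<⇒≱ (subst (_ <_) (+-identityʳ a) b<a+0))
  cycAt-injective {x ∷ xs} {a = a} {b} uniq a≤b b< eq =
    %-injective-window (suc (length xs)) a≤b b<
      (trans (≡-sym (toℕ-fromℕ< _))
        (trans (cong toℕ (lookup-injective uniq _ _ eq)) (toℕ-fromℕ< _)))

-- Hit counts of a sequence of vertices.

-- For `h` a stretch of exits from a vertex `u`, this is the number of uses of the arc from `u` to
-- `w`. Summing over `w` gives the exits from `u`, summing over `u` the entries into `w`.
hits : (ℕ → Fin n) → ℕ → Fin n → ℕ
hits h zero    w = 0
hits h (suc c) w = hits h c w + δ[ h c , w ]

hits-total : ∀ (h : ℕ → Fin n) c → sum (hits h c) ≡ c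
hits-total {n} h zero = ∑-zero {n} (λ _ → refl)
hits-total h (suc c)  =
  trans (∑-distrib-+ (hits h c) (δ[ h c ,_]))
        (trans (cong₂ _+_ (hits-total h c) (∑-δ (h c))) (+-comm c 1))

hits-pos⁻ : ∀ (h : ℕ → Fin n) c {w} → 1 ≤ hits h c w → ∃ λ k → k < c × h k ≡ w
hits-pos⁻ h (suc c) {w} pos with 1 ≤? hits h c w
... | yes pos′ = let k , k<c , eq = hits-pos⁻ h c pos′ in k , m<n⇒m<1+n k<c , eq
... | no  none = c , ≤-refl ,
  δ-pos (subst (λ z → 1 ≤ z + δ[ h c , w ]) (n<1⇒n≡0 (≰⇒> none)) pos)

hits-pos⁺ : ∀ (h : ℕ → Fin n) {c k} → k < c → 1 ≤ hits h c (h k)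
hits-pos⁺ h {suc c} {k} k<1+c with m≤n⇒m<n∨m≡n (≤-pred k<1+c)
... | inj₁ k<c  = ≤-trans (hits-pos⁺ h k<c) (m≤m+n _ _)
... | inj₂ refl = ≤-trans (≤-reflexive (≡-sym (δ-refl (h k)))) (m≤n+m _ _)

hits≤1 : ∀ (h : ℕ → Fin n) c → (∀ {i j} → i < j → j < c → h i ≢ h j) →
         ∀ w → hits h c w ≤ 1
hits≤1 h zero    inj w = z≤n
hits≤1 h (suc c) inj w with 1 ≤? δ[ h c , w ]
... | no none rewrite n<1⇒n≡0 (≰⇒> none) | +-identityʳ (hits h c w) =
  hits≤1 h c (λ i<j j<c → inj i<j (m<n⇒m<1+n j<c)) w
... | yes hit with 1 ≤? hits h c w
...   | no none rewrite n<1⇒n≡0 (≰⇒> none) = ⟦⟧≤1 ⌊ h c ≟F w ⌋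
...   | yes old = let k , k<c , eq = hits-pos⁻ h c old in
  contradiction (trans eq (≡-sym (δ-pos hit))) (inj k<c ≤-refl)

-- Degrees, connectivity and balls.

module _ (G : SimpleGraph n) where

  deg≡∑ : ∀ u → deg G u ≡ ∑[ v < n ] ⟦ adj G u v ⟧
  deg≡∑ u = countFin≡∑ (adj G u)

  ∑adj≡2*edgeCount : ∑[ u < n ] ∑[ v < n ] ⟦ adj G u v ⟧ ≡ 2 * edgeCount G
  ∑adj≡2*edgeCount = double-count (adj G) (irref G) (sym G)

  indegree : ∀ w → ∑[ u < n ] ⟦ adj G u w ⟧ ≡ deg G w
  indegree w = trans (sum-cong-≗ (λ u → cong ⟦_⟧ (sym G u w))) (≡-sym (deg≡∑ w))

  adj⇒1≤deg : ∀ {u v} → adj G u v ≡ true → 1 ≤ deg G u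
  adj⇒1≤deg {u} {v} uv = subst (1 ≤_) (≡-sym (deg≡∑ u))
    (≤-trans (≤-reflexive (cong ⟦_⟧ (≡-sym uv))) (term≤∑ (λ v → ⟦ adj G u v ⟧) v))

  1≤deg⇒adj : ∀ {u} → 1 ≤ deg G u → ∃ λ v → adj G u v ≡ true
  1≤deg⇒adj {u} pos with any? (λ v → adj G u v ≟B true)
  ... | yes found = found
  ... | no  none  = contradiction pos (<⇒≱ (s≤s (≤-reflexive
    (trans (deg≡∑ u) (∑-zero (λ v → ⟦⟧-false (λ uv → none (v , uv))))))))
    where
    ⟦⟧-false : ∀ {b} → b ≢ true → ⟦ b ⟧ ≡ 0
    ⟦⟧-false {true}  b≢ = contradiction refl b≢
    ⟦⟧-false {false} _  = refl

  connected⇒1≤deg : 2 ≤ n → Connected G → ∀ u → 1 ≤ deg G u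
  connected⇒1≤deg 2≤n conn u = let v , u≢v = other 2≤n u in first-step (conn u v) u≢v
    where
    other : ∀ {n} → 2 ≤ n → (u : Fin n) → ∃ λ v → u ≢ v
    other (s≤s (s≤s _)) zero    = suc zero , λ ()
    other (s≤s (s≤s _)) (suc _) = zero , λ ()
    first-step : ∀ {u v} → Reach G u v → u ≢ v → 1 ≤ deg G u
    first-step here        u≢u = contradiction refl u≢u
    first-step (step uw _) _   = adj⇒1≤deg uw

  crossing : (S : Fin n → Bool) → ∀ {a b} → Reach G a b → S a ≡ true → S b ≢ true →
             ∃₂ λ x y → S x ≡ true × S y ≢ true × adj G x y ≡ true
  crossing S here Sa ¬Sb = contradiction Sa ¬Sb
  crossing S (step {w = w} aw path) Sa ¬Sb with S w ≟B true
  ... | yes Sw = crossing S path Sw ¬Sb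
  ... | no ¬Sw = _ , w , Sa , ¬Sw , aw

  module Balls (v : Fin n) where

    -- Boolean-valued, so that the size of a ball is a sum of indicators and can be compared with
    -- degree sums.
    ball : ℕ → Fin n → Bool
    ball zero    u = ⌊ v ≟F u ⌋
    ball (suc k) u = ball k u ∨ ⌊ any? (λ w → (ball k w ∧ adj G w u) ≟B true) ⌋

    ball-centre : ∀ k → ball k v ≡ true
    ball-centre zero = ≟F-refl v
    ball-centre (suc k) rewrite ball-centre k = refl

    ball-suc : ∀ k {u} → ball k u ≡ true → ball (suc k) u ≡ true
    ball-suc k eq rewrite eq = refl

    ball-suc⁺ : ∀ k {w u} → ball k w ≡ true → adj G w u ≡ true → ball (suc k) u ≡ true
    ball-suc⁺ k {w} {u} Bw wu with ball k u | any? (λ w → (ball k w ∧ adj G w u) ≟B true)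
    ... | true  | _       = refl
    ... | false | yes _   = refl
    ... | false | no none = contradiction (w , cong₂ _∧_ Bw wu) none

    ball-suc⁻ : ∀ k {u} → ball (suc k) u ≡ true →
                ball k u ≡ true ⊎ ∃ λ w → ball k w ≡ true × adj G w u ≡ true
    ball-suc⁻ k {u} eq with ball k u | any? (λ w → (ball k w ∧ adj G w u) ≟B true)
    ... | true  | _ = inj₁ refl
    ... | false | yes (w , both) with ball k w in Bw | adj G w u in wu
    ...   | true | true = inj₂ (w , Bw , wu)

    -- A vertex w entering at radius k + 2 has its whole neighbourhood inside
    -- radius k + 3 and outside radius k.
    ball-growth : Connected G → ∀ {δ} → (∀ u → δ ≤ deg G u) →
      ∀ i {u} → ball (i * 3) u ≢ true → i * δ ≤ ∑[ w < n ] ⟦ ball (i * 3) w ⟧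
    ball-growth conn δ≤deg zero    _ = z≤n
    ball-growth conn {δ} δ≤deg (suc i) {u} u∉ = begin
      δ + i * δ
        ≤⟨ +-mono-≤ (δ≤deg w) (ball-growth conn δ≤deg i
             (λ u∈ → u∉ (ball-suc (2 + k) (ball-suc (1 + k) (ball-suc k u∈))))) ⟩
      deg G w + ∑[ y < n ] ⟦ ball k y ⟧
        ≡⟨ cong (_+ ∑[ y < n ] ⟦ ball k y ⟧) (deg≡∑ w) ⟩
      ∑[ y < n ] ⟦ adj G w y ⟧ + ∑[ y < n ] ⟦ ball k y ⟧
        ≡⟨ ∑-distrib-+ (λ y → ⟦ adj G w y ⟧) (λ y → ⟦ ball k y ⟧) ⟨
      ∑[ y < n ] (⟦ adj G w y ⟧ + ⟦ ball k y ⟧)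
        ≤⟨ ∑-mono disjoint ⟩
      ∑[ y < n ] ⟦ ball (3 + k) y ⟧ ∎
      where
      open ≤-Reasoning
      k = i * 3
      exit = crossing (ball (1 + k)) (conn v u) (ball-centre (1 + k))
               (λ u∈ → u∉ (ball-suc (2 + k) (ball-suc (1 + k) u∈)))
      x = proj₁ exit
      w = proj₁ (proj₂ exit)
      x∈ = proj₁ (proj₂ (proj₂ exit))
      w∉ = proj₁ (proj₂ (proj₂ (proj₂ exit)))
      xw = proj₂ (proj₂ (proj₂ (proj₂ exit)))
      disjoint : ∀ y → ⟦ adj G w y ⟧ + ⟦ ball k y ⟧ ≤ ⟦ ball (3 + k) y ⟧
      disjoint y = ⟦⟧-disjoint
        (ball-suc⁺ (2 + k) (ball-suc⁺ (1 + k) x∈ xw))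
        (λ y∈ → ball-suc (2 + k) (ball-suc (1 + k) (ball-suc k y∈)))
        (λ wy y∈ → w∉ (ball-suc⁺ k y∈ (trans (sym G y w) wy)))

≤⟦⟧ : ∀ {m b} → m ≤ 1 → (1 ≤ m → b ≡ true) → m ≤ ⟦ b ⟧
≤⟦⟧ {zero}        m≤1 f = z≤n
≤⟦⟧ {suc zero}    m≤1 f rewrite f ≤-refl = ≤-refl
≤⟦⟧ {suc (suc _)} (s≤s ()) f

-- Single-vertex updates and Boolean tests.

-- Agrees by computation with the rotor update in `stepState`; phases apply it to exit counts as
-- well.
bump : Fin n → (Fin n → ℕ) → Fin n → ℕ
bump x p u = if ⌊ u ≟F x ⌋ then suc (p u) else p u

bump-self : (x : Fin n) (p : Fin n → ℕ) → bump x p x ≡ suc (p x)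
bump-self x p with x ≟F x
... | yes _   = refl
... | no  x≢x = contradiction refl x≢x

bump-other : {x u : Fin n} (p : Fin n → ℕ) → u ≢ x → bump x p u ≡ p u
bump-other {x = x} {u} p u≢x with u ≟F x
... | yes u≡x = contradiction u≡x u≢x
... | no  _   = refl

bump≡+δ : (x : Fin n) (p : Fin n → ℕ) → ∀ u → bump x p u ≡ p u + δ[ x , u ]
bump≡+δ x p u with u ≟F x | x ≟F u
... | yes _    | yes _    = +-comm 1 (p u)
... | no  _    | no  _    = ≡-sym (+-identityʳ (p u))
... | yes refl | no x≢x   = contradiction refl x≢x
... | no  u≢x  | yes refl = contradiction refl u≢x

-- Separates the exits made before a step from the one just made, so that `advance` can extend
-- `reached` and `crossed`.
<bump : ∀ {x u : Fin n} (c : Fin n → ℕ) {k} → k < bump x c u → k < c u ⊎ (u ≡ x × k ≡ c x)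
<bump {x = x} {u} c k< with u ≟F x
... | no  _    = inj₁ k<
... | yes refl with m≤n⇒m<n∨m≡n (≤-pred k<)
...   | inj₁ k<c = inj₁ k<c
...   | inj₂ k≡c = inj₂ (refl , k≡c)

∧-true : ∀ a {b} → a ∧ b ≡ true → a ≡ true × b ≡ true
∧-true true b≡true = refl , b≡true

∨-true : ∀ a {b} → a ∨ b ≡ true → a ≡ true ⊎ b ≡ true
∨-true true  _      = inj₁ refl
∨-true false b≡true = inj₂ b≡true

any-upTo⁺ : ∀ (p : ℕ → Bool) {s t} → s < t → p s ≡ true → any p (upTo t) ≡ true
any-upTo⁺ p s<t ps = Equivalence.to T-≡ (any⁺ p (lose (∈-upTo⁺ s<t) (Equivalence.from T-≡ ps)))

any-upTo⁻ : ∀ (p : ℕ → Bool) {t} → any p (upTo t) ≡ true → ∃ λ s → s < t × p s ≡ true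
any-upTo⁻ p {t} eq with find (any⁻ p (upTo t) (Equivalence.from T-≡ eq))
... | s , s∈ , ps = s , ∈-upTo⁻ s∈ , Equivalence.to T-≡ ps

-- The test inside `traversedEdges`, with which it agrees by computation.
crosses : (x y i j : Fin n) → Bool
crosses x y i j = (⌊ x ≟F i ⌋ ∧ ⌊ y ≟F j ⌋) ∨ (⌊ x ≟F j ⌋ ∧ ⌊ y ≟F i ⌋)

crosses⁺ : {x y i j : Fin n} → (x ≡ i × y ≡ j) ⊎ (x ≡ j × y ≡ i) → crosses x y i j ≡ true
crosses⁺ {x = x} {y} (inj₁ (refl , refl)) rewrite ≟F-refl x | ≟F-refl y = refl
crosses⁺ {x = x} {y} (inj₂ (refl , refl)) rewrite ≟F-refl x | ≟F-refl y = ∨-zeroʳ _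

crosses⁻ : (x y i j : Fin n) → crosses x y i j ≡ true → (x ≡ i × y ≡ j) ⊎ (x ≡ j × y ≡ i)
crosses⁻ x y i j eq with ∨-true (⌊ x ≟F i ⌋ ∧ ⌊ y ≟F j ⌋) eq
... | inj₁ xy = let p , q = ∧-true ⌊ x ≟F i ⌋ xy in inj₁ (≟F-true x i p , ≟F-true y j q)
... | inj₂ yx = let p , q = ∧-true ⌊ x ≟F j ⌋ yx in inj₂ (≟F-true x j p , ≟F-true y i q)

-- Rotor windows and last exits.

module _ {G : SimpleGraph n} (R : RotorSystem G) where

  arc : Fin n → ℕ → Fin n
  arc u k = cycAt (rot R u) u k

  -- The exits from `u` numbered from rotor index `b`, which in a phase is the index at its
  -- beginning.
  window : Fin n → ℕ → ℕ → Fin n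
  window u b k = arc u (b + k)

  arc-adj : ∀ {u} → 1 ≤ length (rot R u) → ∀ k → adj G u (arc u k) ≡ true
  arc-adj {u} pos k = Equivalence.to (rotNbrs R u _) (cycAt-∈ (rot R u) k pos)

  hits≤1-window : ∀ u b {c} → c ≤ length (rot R u) → ∀ w → hits (window u b) c w ≤ 1
  hits≤1-window u b {c} c≤len = hits≤1 (window u b) c λ {i} {j} i<j j<c eq →
    <⇒≢ i<j (+-cancelˡ-≡ b i j (cycAt-injective (rotUnique R u)
      (+-monoʳ-≤ b (<⇒≤ i<j))
      (≤-trans (+-monoʳ-< b (≤-trans j<c c≤len))
               (+-monoˡ-≤ _ (m≤m+n b i)))
      eq))

  hits≤adj : ∀ u b {c} → c ≤ length (rot R u) → ∀ w → hits (window u b) c w ≤ ⟦ adj G u w ⟧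
  hits≤adj u b {c} c≤len w = ≤⟦⟧ (hits≤1-window u b c≤len w) λ pos →
    let k , k<c , eq = hits-pos⁻ (window u b) c pos in
    subst (λ w → adj G u w ≡ true) eq (arc-adj (≤-trans (s≤s z≤n) (≤-trans k<c c≤len)) (b + k))

  -- One full turn hits every neighbour once and nothing else, so its total number of hits is both
  -- the length and the degree.
  length-rot : ∀ u → length (rot R u) ≡ deg G u
  length-rot u = trans (≡-sym (hits-total (window u 0) len))
    (trans (sum-cong-≗ (λ w → ≤-antisym (hits≤adj u 0 ≤-refl w) (adj≤hits w)))
           (≡-sym (deg≡∑ G u)))
    where
    len = length (rot R u)
    adj≤hits : ∀ w → ⟦ adj G u w ⟧ ≤ hits (window u 0) len w
    adj≤hits w with adj G u w in uw
    ... | false = z≤n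
    ... | true with ∈⇒cycAt u (Equivalence.from (rotNbrs R u w) uw)
    ...   | k , k<len , refl = hits-pos⁺ (window u 0) k<len

  -- The hits lie below the adjacency indicators and both add up to the degree, so no neighbour can
  -- be missed.
  full-window : ∀ u b {c} → c ≡ deg G u → ∀ {w} → adj G u w ≡ true →
                ∃ λ k → k < c × window u b k ≡ w
  full-window u b {c} refl {w} uw = hits-pos⁻ (window u b) c
    (subst (λ a → ⟦ a ⟧ ≤ hits (window u b) c w) uw
      (∑-tight (hits≤adj u b (≤-reflexive (≡-sym (length-rot u))))
        (≤-reflexive (≡-sym (trans (hits-total (window u b) c) (deg≡∑ G u)))) w))

  -- p u ≡ suc k says that u was last left through arc u k.
  data LastExit (x : Fin n) (p : Fin n → ℕ) : Fin n → Set where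
    at  : LastExit x p x
    via : ∀ {u k} → p u ≡ suc k → LastExit x p (arc u k) → LastExit x p u

  -- The step replaces only the last exit of `x`. A chain of last exits is followed until it first
  -- meets `x`, and continues from there along the arc just taken.
  LastExit-step : ∀ {x p u} → LastExit x p u → LastExit (arc x (p x)) (bump x p) u
  LastExit-step {x} {p} at = via (bump-self x p) at
  LastExit-step {x} {p} {u} (via eq l) with u ≟F x
  ... | yes refl = via (bump-self x p) at
  ... | no  u≢x  = via (trans (bump-other p u≢x) eq) (LastExit-step l)

  -- Traversed edges of the walk.

  module Walk (1≤deg : ∀ u → 1 ≤ deg G u) (x₀ : Fin n) where

    pos : ℕ → Fin n
    pos = walk R x₀

    rotor : ℕ → Fin n → ℕ
    rotor t = proj₂ (stateAt R x₀ t)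

    traversed : ℕ → Fin n → Fin n → Bool
    traversed t i j = any (λ s → crosses (pos s) (pos (suc s)) i j) (upTo t)

    Traverses : ℕ → Fin n → Fin n → Set
    Traverses s i j = (pos s ≡ i × pos (suc s) ≡ j) ⊎ (pos s ≡ j × pos (suc s) ≡ i)

    traversed⁺ : ∀ {t i j} s → s < t → Traverses s i j → traversed t i j ≡ true
    traversed⁺ {i = i} {j} s s<t trav =
      any-upTo⁺ (λ s → crosses (pos s) (pos (suc s)) i j) s<t (crosses⁺ trav)

    traversed⁻ : ∀ t i j → traversed t i j ≡ true → ∃ λ s → s < t × Traverses s i j
    traversed⁻ t i j eq =
      let s , s<t , hit = any-upTo⁻ (λ s → crosses (pos s) (pos (suc s)) i j) eq
      in s , s<t , crosses⁻ (pos s) (pos (suc s)) i j hit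

    traversed-mono : ∀ {t t′ i j} → t ≤ t′ → traversed t i j ≡ true → traversed t′ i j ≡ true
    traversed-mono {t} {i = i} {j} t≤t′ eq = let s , s<t , trav = traversed⁻ t i j eq in
      traversed⁺ s (≤-trans s<t t≤t′) trav

    traversed-sym : ∀ t i j → traversed t i j ≡ true → traversed t j i ≡ true
    traversed-sym t i j eq with traversed⁻ t i j eq
    ... | s , s<t , inj₁ p = traversed⁺ s s<t (inj₂ p)
    ... | s , s<t , inj₂ p = traversed⁺ s s<t (inj₁ p)

    E : ℕ → ℕ
    E = traversedEdges R x₀

    used : ℕ → Fin n → Fin n → Bool
    used t i j = adj G i j ∧ traversed t i j

    -- `E` counts an edge at its smaller endpoint, `used` counts both orientations. `swap` moves the
    -- order test to the place it has in `traversedEdges`.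
    ∑used≡2*E : ∀ t → ∑[ i < n ] ∑[ j < n ] ⟦ used t i j ⟧ ≡ 2 * E t
    ∑used≡2*E t = trans
      (double-count (used t) (λ i → cong (_∧ traversed t i i) (irref G i)) used-sym)
      (cong (2 *_) (trans (∑-countFin (λ i j → used t i j ∧ (toℕ i <ᵇ toℕ j)))
        (trans (sum-cong-≗ (λ i → sum-cong-≗ (λ j → cong ⟦_⟧ (swap i j))))
          (≡-sym (∑-countFin (λ i j → adj G i j ∧ (toℕ i <ᵇ toℕ j) ∧ traversed t i j))))))
      where
      traversed-comm : ∀ i j → traversed t i j ≡ traversed t j i
      traversed-comm i j with traversed t i j in eq | traversed t j i in eq′
      ... | true  | true  = refl
      ... | false | false = refl
      ... | true  | false = trans (≡-sym (traversed-sym t i j eq)) eq′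
      ... | false | true  = trans (≡-sym eq) (traversed-sym t j i eq′)
      used-sym : ∀ i j → used t i j ≡ used t j i
      used-sym i j = cong₂ _∧_ (sym G i j) (traversed-comm i j)
      swap : ∀ i j → used t i j ∧ (toℕ i <ᵇ toℕ j) ≡ adj G i j ∧ (toℕ i <ᵇ toℕ j) ∧ traversed t i j
      swap i j = trans (∧-assoc (adj G i j) _ _) (cong (adj G i j ∧_) (∧-comm (traversed t i j) _))

    used-mono : ∀ {t t′} i j → t ≤ t′ → used t i j ≡ true → used t′ i j ≡ true
    used-mono {t} i j t≤t′ eq with adj G i j
    ... | true = traversed-mono t≤t′ eq

    E-mono : ∀ {t t′} → t ≤ t′ → E t ≤ E t′
    E-mono {t} {t′} t≤t′ = *-cancelˡ-≤ 2 (subst₂ _≤_ (∑used≡2*E t) (∑used≡2*E t′)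
      (∑-mono (λ i → ∑-mono (λ j → ⟦⟧-mono (used-mono i j t≤t′)))))

    -- Phases and their length.

    open Balls G x₀

    -- After j completed phases, the current one began at time origin with rotors at
    -- base; count records the exits since then.
    record Phase (t j : ℕ) : Set where
      field
        base count : Fin n → ℕ
        origin     : ℕ
        rotor≡     : ∀ u → rotor t u ≡ base u + count u
        count≤deg  : ∀ u → count u ≤ deg G u
        balance    : ∀ w → ∑[ u < n ] hits (window u (base u)) (count u) w + δ[ x₀ , w ]
                           ≡ count w + δ[ pos t , w ]
        clock      : origin + sum count ≡ t
        origin≤    : origin ≤ j * (2 * E t)
        rooted     : ∀ {u} → ball j u ≡ true → LastExit x₀ base u
        kept       : ∀ {u} → ball j u ≡ true → LastExit (pos t) (rotor t) u
        reached    : ∀ {u k} → k < count u → LastExit (pos t) (rotor t) (window u (base u) k)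
        crossed    : ∀ {u k} → k < count u → traversed t u (window u (base u) k) ≡ true
        exhausted  : ∀ {i u w} → i < j → ball i u ≡ true → adj G u w ≡ true →
                     traversed t u w ≡ true

    open Phase

    initial : Phase 0 0
    initial = record
      { base = rotor 0 ; count = λ _ → 0 ; origin = 0
      ; rotor≡    = λ u → ≡-sym (+-identityʳ _)
      ; count≤deg = λ u → z≤n
      ; balance   = λ w → cong (_+ δ[ x₀ , w ]) (∑-zero {n} (λ _ → refl))
      ; clock     = ∑-zero {n} (λ _ → refl)
      ; origin≤   = z≤n
      ; rooted    = λ {u} → from-centre u
      ; kept      = λ {u} → from-centre u
      ; reached   = λ ()
      ; crossed   = λ ()
      ; exhausted = λ ()
      }
      where
      from-centre : ∀ u {p} → ball 0 u ≡ true → LastExit x₀ p u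
      from-centre u eq with refl ← ≟F-true x₀ u eq = at

    -- Only the current vertex gains an exit, and the strict bound leaves room for it. In `balance`
    -- this exit replaces the old position, and the new entry pays for the new position.
    advance : ∀ {t j} (P : Phase t j) → count P (pos t) < deg G (pos t) → Phase (suc t) j
    advance {t} {j} P c<deg = record
      { base = base P ; count = bump x c ; origin = origin P
      ; rotor≡ = λ u → trans (bump≡+δ x (rotor t) u) (trans (cong (_+ δ[ x , u ]) (rotor≡ P u))
                   (trans (+-assoc (b u) (c u) _) (cong (b u +_) (≡-sym (bump≡+δ x c u)))))
      ; count≤deg = cap
      ; balance = bal
      ; clock = trans (cong (origin P +_) (∑-update x 1
                        (trans (bump-self x c) (+-comm 1 _)) (λ u → bump-other c)))
                  (trans (≡-sym (+-assoc (origin P) _ 1)) (trans (+-comm _ 1) (cong suc (clock P))))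
      ; origin≤ = ≤-trans (origin≤ P) (*-monoʳ-≤ j (*-monoʳ-≤ 2 (E-mono (n≤1+n t))))
      ; rooted = rooted P
      ; kept = λ u∈ → LastExit-step (kept P u∈)
      ; reached = λ k< → reach (<bump c k<)
      ; crossed = λ k< → cross (<bump c k<)
      ; exhausted = λ i<j u∈ uw → traversed-mono (n≤1+n t) (exhausted P i<j u∈ uw)
      }
      where
      x = pos t
      b = base P
      c = count P
      next≡ : window x (b x) (c x) ≡ pos (suc t)
      next≡ = cong (arc x) (≡-sym (rotor≡ P x))
      cap : ∀ u → bump x c u ≤ deg G u
      cap u with u ≟F x
      ... | yes refl = c<deg
      ... | no  _    = count≤deg P u
      inflow : (Fin n → ℕ) → Fin n → ℕ
      inflow c w = ∑[ u < n ] hits (window u (b u)) (c u) w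
      inflow-bump : ∀ w → inflow (bump x c) w ≡ inflow c w + δ[ pos (suc t) , w ]
      inflow-bump w = ∑-update x _
        (trans (cong (λ k → hits (window x (b x)) k w) (bump-self x c))
               (cong (λ y → hits (window x (b x)) (c x) w + δ[ y , w ]) next≡))
        (λ u u≢x → cong (λ k → hits (window u (b u)) k w) (bump-other c u≢x))
      bal : ∀ w → inflow (bump x c) w + δ[ x₀ , w ] ≡ bump x c w + δ[ pos (suc t) , w ]
      bal w = begin
        inflow (bump x c) w + δ[ x₀ , w ]   ≡⟨ cong (_+ δ[ x₀ , w ]) (inflow-bump w) ⟩
        inflow c w + y + δ[ x₀ , w ]        ≡⟨ +-assoc (inflow c w) y _ ⟩
        inflow c w + (y + δ[ x₀ , w ])      ≡⟨ cong (inflow c w +_) (+-comm y _) ⟩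
        inflow c w + (δ[ x₀ , w ] + y)      ≡⟨ +-assoc (inflow c w) _ y ⟨
        inflow c w + δ[ x₀ , w ] + y        ≡⟨ cong (_+ y) (balance P w) ⟩
        c w + δ[ x , w ] + y                ≡⟨ cong (_+ y) (bump≡+δ x c w) ⟨
        bump x c w + y                      ∎
        where
        open ≡-Reasoning
        y = δ[ pos (suc t) , w ]
      reach : ∀ {u k} → k < c u ⊎ (u ≡ x × k ≡ c x) →
              LastExit (pos (suc t)) (rotor (suc t)) (window u (b u) k)
      reach (inj₁ k<c)           = LastExit-step (reached P k<c)
      reach (inj₂ (refl , refl)) = subst (LastExit _ _) (≡-sym next≡) at
      cross : ∀ {u k} → k < c u ⊎ (u ≡ x × k ≡ c x) →
              traversed (suc t) u (window u (b u) k) ≡ true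
      cross (inj₁ k<c)           = traversed-mono (n≤1+n t) (crossed P k<c)
      cross (inj₂ (refl , refl)) = traversed⁺ t ≤-refl (inj₁ (refl , ≡-sym next≡))

    count≤length : ∀ {t j} (P : Phase t j) u → count P u ≤ length (rot R u)
    count≤length P u = subst (count P u ≤_) (≡-sym (length-rot u)) (count≤deg P u)

    -- A phase uses no arc twice, and each arc it uses is one of the two orientations of a traversed
    -- edge.
    ∑count≤2*E : ∀ {t j} (P : Phase t j) → sum (count P) ≤ 2 * E t
    ∑count≤2*E {t} P = subst₂ _≤_
      (sum-cong-≗ (λ u → hits-total (window u (base P u)) (count P u))) (∑used≡2*E t)
      (∑-mono (λ u → ∑-mono (λ w →
        ≤⟦⟧ (hits≤1-window u (base P u) (count≤length P u) w) (is-used u))))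
      where
      is-used : ∀ u {w} → 1 ≤ hits (window u (base P u)) (count P u) w → used t u w ≡ true
      is-used u pos with hits-pos⁻ (window u (base P u)) (count P u) pos
      ... | k , k<c , refl =
        cong₂ _∧_ (arc-adj (≤-trans (≤-trans (s≤s z≤n) k<c) (count≤length P u)) _) (crossed P k<c)

    -- The completed phases and the current one are each charged `2 * E t` steps. In `renew` this
    -- bound becomes `origin≤` of the next phase.
    time≤ : ∀ {t j} → Phase t j → t ≤ suc j * (2 * E t)
    time≤ {t} {j} P = begin
      t                         ≡⟨ clock P ⟨
      origin P + sum (count P)   ≤⟨ +-mono-≤ (origin≤ P) (∑count≤2*E P) ⟩
      j * (2 * E t) + 2 * E t   ≡⟨ +-comm _ (2 * E t) ⟩
      suc j * (2 * E t)         ∎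
      where open ≤-Reasoning

    -- The end of a phase.

    module _ {t j} (P : Phase t j) where

      inflow≤deg : ∀ w → ∑[ u < n ] hits (window u (base P u)) (count P u) w ≤ deg G w
      inflow≤deg w = ≤-trans (∑-mono (λ u → hits≤adj u (base P u) (count≤length P u) w))
                             (≤-reflexive (indegree G w))

      -- At the current vertex the entries and the start indicator together exceed the exits by one.
      -- There are already as many exits as the degree and at most as many entries, so the start
      -- indicator must be 1.
      closed : count P (pos t) ≡ deg G (pos t) → x₀ ≡ pos t
      closed full = δ-pos (+-cancelˡ-≤ (deg G x) _ _ (begin
        deg G x + 1                      ≡⟨ cong (deg G x +_) (δ-refl x) ⟨
        deg G x + δ[ x , x ]             ≡⟨ cong (_+ δ[ x , x ]) full ⟨
        count P x + δ[ x , x ]           ≡⟨ balance P x ⟨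
        _ + δ[ x₀ , x ]                  ≤⟨ +-monoˡ-≤ _ (inflow≤deg x) ⟩
        deg G x + δ[ x₀ , x ]            ∎))
        where
        open ≤-Reasoning
        x = pos t

      -- If the head of a last exit is saturated then, by balance, so are all arcs
      -- into it; the last exit of u comes up again only after a full turn of the rotor.
      saturated : count P (pos t) ≡ deg G (pos t) → ∀ {u} → LastExit x₀ (base P) u →
                  count P u ≡ deg G u
      saturated full at = subst (λ x → count P x ≡ deg G x) (≡-sym (closed full)) full
      saturated full {u} (via {k = k} b≡1+k l) = ≤-antisym (count≤deg P u)
        (≤-trans (≤-reflexive (≡-sym (length-rot u))) (≤-trans full-turn k′<c))
        where
        w = arc u k
        1≤len : 1 ≤ length (rot R u)
        1≤len = subst (1 ≤_) (≡-sym (length-rot u)) (1≤deg u)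
        inflow : ℕ
        inflow = ∑[ u < n ] hits (window u (base P u)) (count P u) w
        inflow≡ : inflow ≡ deg G w
        inflow≡ = trans (+-cancelʳ-≡ δ[ pos t , w ] _ _
                    (trans (cong (λ x → inflow + δ[ x , w ]) (≡-sym (closed full))) (balance P w)))
                  (saturated full l)
        again : ∃ λ k′ → k′ < count P u × window u (base P u) k′ ≡ w
        again = hits-pos⁻ (window u (base P u)) (count P u)
          (subst (λ a → ⟦ a ⟧ ≤ hits (window u (base P u)) (count P u) w) (arc-adj 1≤len k)
            (∑-tight (λ u → hits≤adj u (base P u) (count≤length P u) w)
              (≤-reflexive (trans (indegree G w) (≡-sym inflow≡))) u))
        k′ = proj₁ again
        k′<c = proj₁ (proj₂ again)
        -- The last exit before the phase has rotor index `k`, its repetition has index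
        -- `suc k + k′`. The gap is `suc k′`, and equal heads at distinct indices are at least a
        -- full turn apart.
        full-turn : length (rot R u) ≤ suc k′
        full-turn = ≮⇒≥ λ 1+k′<len → m≢1+m+n k (cycAt-injective (rotUnique R u)
          (≤-trans (n≤1+n k) (m≤m+n (suc k) k′))
          (≤-trans (≤-reflexive (cong suc (≡-sym (+-suc k k′)))) (+-monoʳ-< k 1+k′<len))
          (≡-sym (trans (cong (λ b → arc u (b + k′)) (≡-sym b≡1+k)) (proj₂ (proj₂ again)))))

    -- The phase ends at `x₀`, so the present last exits can serve as `rooted` for the next one. By
    -- `rooted` and `saturated` every vertex of the old ball has used all its arcs: its neighbours
    -- have been reached, which enlarges the radius, and its arcs are exhausted.
    renew : ∀ {t j} (P : Phase t j) → count P (pos t) ≡ deg G (pos t) →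
            Σ (Phase t (suc j)) λ P′ → count P′ (pos t) ≡ 0
    renew {t} {j} P full = record
      { base = rotor t ; count = λ _ → 0 ; origin = t
      ; rotor≡    = λ u → ≡-sym (+-identityʳ _)
      ; count≤deg = λ u → z≤n
      ; balance   = λ w → cong₂ _+_ (∑-zero {n} (λ _ → refl)) (cong (λ x → δ[ x , w ]) (closed P full))
      ; clock     = trans (cong (t +_) (∑-zero {n} (λ _ → refl))) (+-identityʳ t)
      ; origin≤   = time≤ P
      ; rooted    = λ u∈ → subst (λ x → LastExit x (rotor t) _) (≡-sym (closed P full)) (grow u∈)
      ; kept      = grow
      ; reached   = λ ()
      ; crossed   = λ ()
      ; exhausted = λ i<1+j → exhaust (m≤n⇒m<n∨m≡n (≤-pred i<1+j))
      } , refl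
      where
      ball-saturated : ∀ {u} → ball j u ≡ true → count P u ≡ deg G u
      ball-saturated u∈ = saturated P full (rooted P u∈)
      grow : ∀ {u} → ball (suc j) u ≡ true → LastExit (pos t) (rotor t) u
      grow u∈ with ball-suc⁻ j u∈
      ... | inj₁ u∈′ = kept P u∈′
      ... | inj₂ (w , w∈ , wu) with full-window w (base P w) (ball-saturated w∈) wu
      ...   | k , k<c , refl = reached P k<c
      exhaust : ∀ {i u w} → i < j ⊎ i ≡ j → ball i u ≡ true → adj G u w ≡ true →
                traversed t u w ≡ true
      exhaust (inj₁ i<j) u∈ uw = exhausted P i<j u∈ uw
      exhaust {u = u} (inj₂ refl) u∈ uw with full-window u (base P u) (ball-saturated u∈) uw
      ... | k , k<c , refl = crossed P k<c

    some-phase : ∀ t → ∃ (Phase t)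
    some-phase zero = 0 , initial
    some-phase (suc t) with some-phase t
    ... | j , P with m≤n⇒m<n∨m≡n (count≤deg P (pos t))
    ...   | inj₁ c<deg = j , advance P c<deg
    -- Renewal takes no time. The fresh count is 0, below the positive degree, so the pending step
    -- can be made in the new phase.
    ...   | inj₂ full  = let P′ , c≡0 = renew P full in
      suc j , advance P′ (subst (_< deg G (pos t)) (≡-sym c≡0) (1≤deg (pos t)))

-- Arithmetic of the time bounds, multiplied out by the squared minimum degree.

thirds : ∀ j → ∃ λ i → i * 3 ≤ j × j ≤ 2 + i * 3
thirds 0 = 0 , z≤n , z≤n
thirds 1 = 0 , z≤n , s≤s z≤n
thirds 2 = 0 , z≤n , s≤s (s≤s z≤n)
thirds (suc (suc (suc j))) =
  let i , lo , hi = thirds j in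
  suc i , s≤s (s≤s (s≤s lo)) , s≤s (s≤s (s≤s hi))

budget-mono : ∀ δ {a b} → a ≤ b → 13 * (a * δ ^ 2 + a ^ 2) ≤ 13 * (b * δ ^ 2 + b ^ 2)
budget-mono δ a≤b = *-monoʳ-≤ 13 (+-mono-≤ (*-monoˡ-≤ (δ ^ 2) a≤b) (^-monoˡ-≤ 2 a≤b))

first-phase-budget : ∀ e d → 1 * (2 * e) * d ≤ 12 * (e * d + e * e)
first-phase-budget e d = begin
  1 * (2 * e) * d                                   ≤⟨ m≤m+n _ _ ⟩
  1 * (2 * e) * d + (10 * (e * d) + 12 * (e * e))   ≡⟨ expand e d ⟩
  12 * (e * d + e * e)                              ∎
  where
  open ≤-Reasoning
  expand : ∀ e d → 1 * (2 * e) * d + (10 * (e * d) + 12 * (e * e)) ≡ 12 * (e * d + e * e)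
  expand = solve-∀

-- Here `e` stands for the traversed edges and `d` for the squared minimum degree. The term in `i`
-- yields 6 times 2 copies of `e * e`, whence the 12; the rounding of `j` costs only 8 copies of
-- `e * d`.
later-phase-budget : ∀ {j} i e d → j ≤ 2 + i * 3 → i * d ≤ 2 * e →
                     suc (suc j) * (2 * e) * d ≤ 12 * (e * d + e * e)
later-phase-budget {j} i e d j≤2+i*3 i*d≤2*e = begin
  suc (suc j) * (2 * e) * d                     ≤⟨ *-monoˡ-≤ d (*-monoˡ-≤ (2 * e) (s≤s (s≤s j≤2+i*3))) ⟩
  (4 + i * 3) * (2 * e) * d                     ≡⟨ regroup i e d ⟩
  8 * (e * d) + 6 * e * (i * d)                 ≤⟨ +-monoʳ-≤ (8 * (e * d)) (*-monoʳ-≤ (6 * e) i*d≤2*e) ⟩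
  8 * (e * d) + 6 * e * (2 * e)                 ≤⟨ m≤m+n _ (4 * (e * d)) ⟩
  8 * (e * d) + 6 * e * (2 * e) + 4 * (e * d)   ≡⟨ expand e d ⟩
  12 * (e * d + e * e)                          ∎
  where
  open ≤-Reasoning
  regroup : ∀ i e d → (4 + i * 3) * (2 * e) * d ≡ 8 * (e * d) + 6 * e * (i * d)
  regroup = solve-∀
  expand : ∀ e d → 8 * (e * d) + 6 * e * (2 * e) + 4 * (e * d) ≡ 12 * (e * d + e * e)
  expand = solve-∀

-- Rates of exploring edges and vertices.

module Cover {G : SimpleGraph n} (R : RotorSystem G) (conn : Connected G)
             (1≤deg : ∀ u → 1 ≤ deg G u) (x₀ : Fin n) where

  open Walk R 1≤deg x₀
  open Balls G x₀

  m : ℕ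
  m = edgeCount G

  used≤adj : ∀ t i j → ⟦ used t i j ⟧ ≤ ⟦ adj G i j ⟧
  used≤adj t i j = ⟦⟧-mono (λ eq → proj₁ (∧-true (adj G i j) eq))

  -- Used arcs are arcs and the totals agree, so tightness applies first to the rows and then to the
  -- entries.
  adj⇒used : ∀ {t} → m ≤ E t → ∀ i j → adj G i j ≡ true → used t i j ≡ true
  adj⇒used {t} m≤E i j ij = ⟦⟧-pos (subst (λ a → ⟦ a ⟧ ≤ ⟦ used t i j ⟧) ij
    (∑-tight (used≤adj t i)
      (∑-tight (λ i → ∑-mono (used≤adj t i)) total i) j))
    where
    total = subst₂ _≤_ (≡-sym (∑adj≡2*edgeCount G)) (≡-sym (∑used≡2*E t)) (*-monoʳ-≤ 2 m≤E)

  all-traversed⇒m≤E : ∀ t → (∀ u w → adj G u w ≡ true → traversed t u w ≡ true) → m ≤ E t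
  all-traversed⇒m≤E t all = *-cancelˡ-≤ 2
    (subst₂ _≤_ (∑adj≡2*edgeCount G) (∑used≡2*E t)
      (∑-mono (λ u → ∑-mono (λ w → ⟦⟧-mono (λ uw → cong₂ _∧_ uw (all u w uw))))))

  module _ {δ} (δ≤deg : ∀ u → δ ≤ deg G u) where

    -- A ball containing every vertex would make all edges traversed, against `E t < m`. Otherwise
    -- `ball-growth` gives at least `i * δ` vertices, each with at least `δ` used arcs, and every
    -- edge supplies two arcs.
    exhausted-ball : ∀ t i → (∀ {u w} → ball (i * 3) u ≡ true → adj G u w ≡ true →
                              traversed t u w ≡ true) →
                     E t < m → i * (δ * δ) ≤ 2 * E t
    exhausted-ball t i exh E<m with any? (λ u → ball (i * 3) u ≟B false)
    ... | no none = contradiction E<m (≤⇒≯ (all-traversed⇒m≤E t λ u w →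
      exh (¬-not (λ u∉ → none (u , u∉)))))
    ... | yes (u , u∉) = begin
      i * (δ * δ)                                  ≡⟨ *-assoc i δ δ ⟨
      i * δ * δ                                    ≤⟨ *-monoˡ-≤ δ (ball-growth conn δ≤deg i
                                                        (λ u∈ → not-¬ u∈ u∉)) ⟩
      (∑[ u < n ] ⟦ ball (i * 3) u ⟧) * δ            ≡⟨ ∑-*ʳ (λ u → ⟦ ball (i * 3) u ⟧) δ ⟨
      ∑[ u < n ] (⟦ ball (i * 3) u ⟧ * δ)          ≤⟨ ∑-mono row ⟩
      ∑[ u < n ] ∑[ w < n ] ⟦ used t u w ⟧         ≡⟨ ∑used≡2*E t ⟩
      2 * E t                                      ∎
      where
      open ≤-Reasoning
      adj≤used : ∀ {u} → ball (i * 3) u ≡ true → ∀ w → ⟦ adj G u w ⟧ ≤ ⟦ used t u w ⟧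
      adj≤used u∈ w = ⟦⟧-mono (λ uw → cong₂ _∧_ uw (exh u∈ uw))
      row : ∀ u → ⟦ ball (i * 3) u ⟧ * δ ≤ ∑[ w < n ] ⟦ used t u w ⟧
      row u with ball (i * 3) u in u∈
      ... | false = z≤n
      ... | true  = begin
        1 * δ                        ≡⟨ *-identityˡ δ ⟩
        δ                            ≤⟨ δ≤deg u ⟩
        deg G u                      ≡⟨ deg≡∑ G u ⟩
        ∑[ w < n ] ⟦ adj G u w ⟧     ≤⟨ ∑-mono (adj≤used u∈) ⟩
        ∑[ w < n ] ⟦ used t u w ⟧    ∎

    exploration-rate : ∀ t → E t < m →
      t * (δ * δ) ≤ 12 * (E t * (δ * δ) + E t * E t)
    exploration-rate t E<m with some-phase t
    ... | zero , P = ≤-trans (*-monoˡ-≤ (δ * δ) (time≤ P)) (first-phase-budget (E t) (δ * δ))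
    ... | suc j , P =
      -- After `suc j` phases the radii up to `j` are exhausted; `i * 3` is the largest multiple of
      -- three among them.
      let i , i*3≤j , j≤2+i*3 = thirds j in
      ≤-trans (*-monoˡ-≤ (δ * δ) (time≤ P))
        (later-phase-budget i (E t) (δ * δ) j≤2+i*3
          (exhausted-ball t i (Phase.exhausted P (s≤s i*3≤j)) E<m))

    -- If fewer than `M` edges were traversed at the chosen time, `exploration-rate` would keep
    -- `t * d` within `bound`, which it exceeds by choice.
    edges-within : 1 ≤ δ → ∀ M → 1 ≤ M → M ≤ m →
      ∃ λ t → t * δ ^ 2 ≤ 13 * (M * δ ^ 2 + M ^ 2) × M ≤ E t
    edges-within 1≤δ M 1≤M M≤m = t ,
      subst₂ (λ a b → t * a ≤ 13 * (M * a + b)) (square δ) (square M) in-time ,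
      ≮⇒≥ λ E<M → <⇒≱ too-late (begin
        t * d                          ≤⟨ exploration-rate t (≤-trans E<M M≤m) ⟩
        12 * (E t * d + E t * E t)     ≤⟨ *-monoʳ-≤ 12 (+-mono-≤ (*-monoˡ-≤ d (<⇒≤ E<M))
                                            (*-mono-≤ (<⇒≤ E<M) (<⇒≤ E<M))) ⟩
        bound                          ∎)
      where
      open ≤-Reasoning
      square : ∀ a → a * a ≡ a ^ 2
      square a = cong (a *_) (≡-sym (*-identityʳ a))
      d = δ * δ
      bound = 12 * (M * d + M * M)
      instance
        d≢0 : NonZero d
        d≢0 = >-nonZero (*-mono-≤ 1≤δ 1≤δ)
      -- The least time with `t * d` above `bound`. Rounding up costs one `d`, at most `M * d`,
      -- which turns 12 into 13.
      t = suc (bound / d)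
      too-late : bound < t * d
      too-late = begin-strict
        bound                              ≡⟨ m≡m%n+[m/n]*n bound d ⟩
        bound % d + bound / d * d          <⟨ +-monoˡ-< (bound / d * d) (m%n<n bound d) ⟩
        t * d                              ∎
      in-time : t * d ≤ 13 * (M * d + M * M)
      in-time = begin
        d + bound / d * d                  ≤⟨ +-mono-≤ (≤-trans (≤-reflexive (≡-sym (*-identityˡ d)))
                                                (*-monoˡ-≤ d 1≤M)) (m/n*n≤m bound d) ⟩
        M * d + bound                      ≤⟨ +-monoˡ-≤ bound (m≤m+n (M * d) (M * M)) ⟩
        13 * (M * d + M * M)               ∎

  visited : ℕ → Fin n → Bool
  visited t v = any (λ s → ⌊ pos s ≟F v ⌋) (upTo (suc t))

  V : ℕ → ℕ
  V = visitedVertices R x₀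

  used⇒visited : ∀ {t i j} → used t i j ≡ true → visited t i ≡ true
  used⇒visited {t} {i} {j} eq
    with traversed⁻ t i j (proj₂ (∧-true (adj G i j) eq))
  ... | s , s<t , inj₁ (refl , _) = any-upTo⁺ _ (m<n⇒m<1+n s<t) (≟F-refl i)
  -- Here `i` is entered at time `suc s`, possibly equal to `t`, which the range of `visited`
  -- includes.
  ... | s , s<t , inj₂ (_ , refl) = any-upTo⁺ (λ s → ⌊ pos s ≟F i ⌋) (s≤s s<t) (≟F-refl i)

  -- Both orientations of a traversed edge start at visited vertices, and at most `Δ` arcs start at
  -- each of them.
  E≤V*Δ : ∀ {Δ} → (∀ u → deg G u ≤ Δ) → ∀ t → E t ≤ V t * Δ
  E≤V*Δ {Δ} deg≤Δ t = begin
    E t                                     ≤⟨ m≤m+n (E t) _ ⟩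
    2 * E t                                 ≡⟨ ∑used≡2*E t ⟨
    ∑[ i < n ] ∑[ j < n ] ⟦ used t i j ⟧    ≤⟨ ∑-mono row ⟩
    ∑[ i < n ] (⟦ visited t i ⟧ * Δ)        ≡⟨ ∑-*ʳ (λ i → ⟦ visited t i ⟧) Δ ⟩
    (∑[ i < n ] ⟦ visited t i ⟧) * Δ        ≡⟨ cong (_* Δ) (countFin≡∑ (visited t)) ⟨
    V t * Δ                                 ∎
    where
    open ≤-Reasoning
    unused : ∀ {i j} → visited t i ≡ false → ⟦ used t i j ⟧ ≡ 0
    unused {i} {j} unvisited with used t i j in eq
    ... | false = refl
    ... | true  = contradiction unvisited (not-¬ (used⇒visited {t} {i} {j} eq))
    row : ∀ i → ∑[ j < n ] ⟦ used t i j ⟧ ≤ ⟦ visited t i ⟧ * Δ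
    row i = case visited t i ≟B true of λ where
      (yes vis) → begin
        ∑[ j < n ] ⟦ used t i j ⟧    ≤⟨ ∑-mono (used≤adj t i) ⟩
        ∑[ j < n ] ⟦ adj G i j ⟧     ≡⟨ deg≡∑ G i ⟨
        deg G i                      ≤⟨ deg≤Δ i ⟩
        Δ                            ≡⟨ *-identityˡ Δ ⟨
        1 * Δ                        ≡⟨ cong (λ b → ⟦ b ⟧ * Δ) vis ⟨
        ⟦ visited t i ⟧ * Δ          ∎
      (no ¬vis) → ≤-trans (≤-reflexive (∑-zero (λ j → unused {i} {j} (¬-not ¬vis)))) z≤n

  -- Every vertex has an incident edge, and this edge has been traversed.
  m≤E⇒n≤V : ∀ t → m ≤ E t → n ≤ V t
  m≤E⇒n≤V t m≤E = subst₂ _≤_ (∑-const n) (≡-sym (countFin≡∑ (visited t)))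
    (∑-mono λ i → let j , ij = 1≤deg⇒adj G (1≤deg i) in
      ≤-reflexive (cong ⟦_⟧ (≡-sym (used⇒visited {t} {i} {j} (adj⇒used {t} m≤E i j ij)))))

  1≤m : 1 ≤ m
  1≤m = *-cancelˡ-< 2 0 m (subst (1 ≤_) (∑adj≡2*edgeCount G)
    (≤-trans (subst (1 ≤_) (deg≡∑ G x₀) (1≤deg x₀))
             (term≤∑ (λ u → ∑[ v < n ] ⟦ adj G u v ⟧) x₀)))

  -- If `N * Δ` is at most `m`, traversing that many edges forces `N` visited vertices; otherwise
  -- all edges are traversed. Either way the smaller of the two budgets is met, and monotonicity
  -- gives the other.
  vertices-within : ∀ {δ Δ} → (∀ u → δ ≤ deg G u) → (∀ u → deg G u ≤ Δ) → 1 ≤ δ →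
    ∀ N → 1 ≤ N → N ≤ n →
    ∃ λ t → (t * δ ^ 2 ≤ 13 * (N * Δ * δ ^ 2 + (N * Δ) ^ 2))
          × (t * δ ^ 2 ≤ 13 * (m * δ ^ 2 + m ^ 2))
          × N ≤ V t
  vertices-within {δ} {Δ} δ≤deg deg≤Δ 1≤δ N 1≤N N≤n with N * Δ ≤? m
  ... | yes NΔ≤m =
    let t , t≤ , NΔ≤E = edges-within δ≤deg 1≤δ (N * Δ) (*-mono-≤ 1≤N 1≤Δ) NΔ≤m in
    t , t≤ , ≤-trans t≤ (budget-mono δ NΔ≤m) ,
    *-cancelʳ-≤ N (V t) Δ {{>-nonZero 1≤Δ}} (≤-trans NΔ≤E (E≤V*Δ deg≤Δ t))
    where
    1≤Δ : 1 ≤ Δ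
    1≤Δ = ≤-trans (1≤deg x₀) (deg≤Δ x₀)
  ... | no NΔ≰m =
    let t , t≤ , m≤E = edges-within δ≤deg 1≤δ m 1≤m ≤-refl in
    t , ≤-trans t≤ (budget-mono δ (<⇒≤ (≰⇒> NΔ≰m))) , t≤ ,
    ≤-trans N≤n (m≤E⇒n≤V t m≤E)

theorem5p1 : Σ ℕ λ C →
    ∀ (n : ℕ) → 2 ≤ n → (G : SimpleGraph n) → Connected G →
    ∀ (δ Δ : ℕ) → IsMinDegree G δ → IsMaxDegree G Δ →
    (R : RotorSystem G) → (x₀ : Fin n) →
    (∀ (N : ℕ) → 1 ≤ N → N ≤ n →
    ∃ λ t → (t * δ ^ 2 ≤ C * (N * Δ * δ ^ 2 + (N * Δ) ^ 2))
    × (t * δ ^ 2 ≤ C * (edgeCount G * δ ^ 2 + edgeCount G ^ 2))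
    × N ≤ visitedVertices R x₀ t)
    × (∀ (M : ℕ) → 1 ≤ M → M ≤ edgeCount G →
    ∃ λ t → (t * δ ^ 2 ≤ C * (M * δ ^ 2 + M ^ 2))
    × M ≤ traversedEdges R x₀ t)
theorem5p1 = 13 , λ n 2≤n G conn δ Δ (δ≤deg , u , deg≡δ) (deg≤Δ , _) R x₀ →
  let 1≤deg = connected⇒1≤deg G 2≤n conn
      1≤δ   = subst (1 ≤_) deg≡δ (1≤deg u)
      open Cover R conn 1≤deg x₀
  in vertices-within δ≤deg deg≤Δ 1≤δ , edges-within δ≤deg 1≤δ
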